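{- Let $n\geq 3$ be an integer. Then $$t(n,3,6)\leq 2n-3.$$
   Context: All graphs are finite, undirected and simple. Let $G$ be a nontrivial connected graph of order $n$ (i.e. with $n$ vertices). An edge-coloring of $G$ is any assignment of colors to the edges (adjacent edges may receive the same color). A tree $T$ that is a subgraph of $G$ is a rainbow tree if no two edges of $T$ have the same color. For $S\subseteq V(G)$ with $|S|\geq 2$, a rainbow $S$-tree is a rainbow tree $T$ in $G$ with $S\subseteq V(T)$. For an integer $k$ with $2\leq k\leq n$, an edge-coloring of $G$ is a $k$-rainbow coloring if for every $k$-subset $S$ of $V(G)$ there exists a rainbow $S$-tree. The $k$-rainbow index $rx_k(G)$ is the minimum number of colors needed in a $k$-rainbow coloring of $G$. For integers $2\leq k\leq n$ and $\ell\geq 2$, $t(n,k,\ell)$ denotes the minimum size (number of edges) of a connected graph $G$ of order $n$ with $rx_k(G)\leq \ell$ (when such a graph exists). -}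

module Defs where

open import Data.Bool using (Bool; false; T)
open import Data.Bool.Properties using (T?)
open import Data.Fin using (Fin; _<_; _<?_)
open import Data.Fin.Subset using (Subset; _∈_; _⊆_; ∣_∣)
open import Data.List using (List; []; _∷_; _++_; length; filter; allFin; cartesianProduct)
open import Data.List.Relation.Unary.Linked using (Linked)
open import Data.List.Relation.Unary.Unique.Propositional using (Unique)
open import Data.Nat using (ℕ; _≤_)
open import Data.Product using (Σ; ∃-syntax; _×_; _,_)
open import Data.Sum using (_⊎_)
open import Level using (0ℓ)
open import Relation.Binary using (Rel)
open import Relation.Binary.Construct.Closure.ReflexiveTransitive using (Star)
open import Relation.Binary.PropositionalEquality using (_≡_)
open import Relation.Nullary using (¬_)
open import Relation.Nullary.Decidable using (_×-dec_)

record Graph (n : ℕ) : Set where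
  field
    adj        : Fin n → Fin n → Bool
    adj-sym    : ∀ u v → adj u v ≡ adj v u
    adj-irrefl : ∀ u → adj u u ≡ false

  Adj : Rel (Fin n) 0ℓ
  Adj u v = T (adj u v)

  -- Each edge uv is listed once, as the pair with u < v.
  edges : List (Fin n × Fin n)
  edges = filter (λ (u , v) → (u <? v) ×-dec T? (adj u v))
                 (cartesianProduct (allFin n) (allFin n))

  size : ℕ
  size = length edges

open Graph public using (Adj; size)

Connected : ∀ {n} → Graph n → Set
Connected G = ∀ u v → Star (Adj G) u v

-- A cycle v₀ v₁ … vⱼ v₀ with v₀, …, vⱼ distinct and j ≥ 2.
Cycle : ∀ {n} → Graph n → Set
Cycle G = ∃[ v ] ∃[ vs ]
  2 ≤ length vs × Unique (v ∷ vs) × Linked (Adj G) (v ∷ vs ++ v ∷ [])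

-- A subgraph is a vertex set together with a set of edges of G having both
-- ends in that vertex set; the edge set is stored as a graph on all of Fin n
-- in which the remaining vertices are isolated.
record Subgraph {n : ℕ} (G : Graph n) : Set where
  field
    vertices : Subset n
    edgeSet  : Graph n
    edge⇒Adj : ∀ {u v} → Adj edgeSet u v → Adj G u v
    edge⇒end : ∀ {u v} → Adj edgeSet u v → u ∈ vertices × v ∈ vertices

open Subgraph public using (vertices; edgeSet; edge⇒Adj)

record IsTree {n : ℕ} {G : Graph n} (H : Subgraph G) : Set where
  field
    nonempty  : ∃[ v ] v ∈ vertices H
    connected : ∀ {u v} → u ∈ vertices H → v ∈ vertices H → Star (Adj (edgeSet H)) u v
    acyclic   : ¬ Cycle (edgeSet H)

-- An arbitrary assignment of colours from an r-element palette to the edges;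
-- colour-sym makes the colour a function of the unordered pair.
record EdgeColoring {n : ℕ} (G : Graph n) (r : ℕ) : Set where
  field
    colour     : ∀ {u v} → Adj G u v → Fin r
    colour-sym : ∀ {u v} (p : Adj G u v) (q : Adj G v u) → colour p ≡ colour q

open EdgeColoring public using (colour)

Rainbow : ∀ {n r} {G : Graph n} → EdgeColoring G r → Subgraph G → Set
Rainbow c H = ∀ {u v x y} (p : Adj (edgeSet H) u v) (q : Adj (edgeSet H) x y) →
  colour c (edge⇒Adj H p) ≡ colour c (edge⇒Adj H q) →
  (u ≡ x × v ≡ y) ⊎ (u ≡ y × v ≡ x)

RainbowTree : ∀ {n r} {G : Graph n} → EdgeColoring G r → Subset n → Set
RainbowTree {G = G} c S =
  Σ (Subgraph G) λ H → IsTree H × Rainbow c H × S ⊆ vertices H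

IsRainbowColoring : ∀ {n r} {G : Graph n} → ℕ → EdgeColoring G r → Set
IsRainbowColoring {n} k c = (S : Subset n) → ∣ S ∣ ≡ k → RainbowTree c S

IsMinimum : (ℕ → Set) → ℕ → Set
IsMinimum P m = P m × (∀ j → P j → m ≤ j)

-- "rx_k(G) = r".  A palette of r colours need not be exhausted, which does not
-- affect the minimum.
IsRainbowIndex : ∀ {n} → ℕ → Graph n → ℕ → Set
IsRainbowIndex k G = IsMinimum λ r → Σ (EdgeColoring G r) (IsRainbowColoring k)

RainbowIndex≤ : ∀ {n} → ℕ → Graph n → ℕ → Set
RainbowIndex≤ k G ℓ = ∃[ r ] IsRainbowIndex k G r × r ≤ ℓ

-- "t(n,k,ℓ) = m", a relation because the minimum exists only when some
-- connected graph of order n has rx_k ≤ ℓ.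
IsMinSize : ℕ → ℕ → ℕ → ℕ → Set
IsMinSize n k ℓ = IsMinimum λ m →
  Σ (Graph n) λ G → Connected G × RainbowIndex≤ k G ℓ × size G ≡ m

{-# OPTIONS --safe #-}

-- The upper bound is witnessed by the fan, a hub (vertex zero) joined to every
-- vertex of a path p₀ p₁ … (pᵢ is vertex suc i), which has 2n − 3 edges.  The
-- spoke to pᵢ gets the spoke colour i mod 3 and the path edge pᵢpᵢ₊₁ the rim
-- colour i mod 3, six colours in all.
-- A path vertex reaches the hub either along its own spoke or by stepping to a
-- neighbour, whose spoke colour differs.  If i < j < k are congruent mod 3, the
-- routes pᵢpᵢ₊₁, pⱼ and pₖpₖ₋₁ have spoke colours in different classes, and
-- their rim edges have colours i and i − 1.  If exactly two of the three agree,
-- moving the smaller one up or the larger one down reaches the third class.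
-- Existence of the exact minimum t(n,3,6) is a constructive matter: graphs,
-- colourings and subtrees of bounded order can be searched exhaustively.

module Submission where

open import Defs
open import Data.Bool using (Bool; true; false; T; _∨_)
import Data.Bool.Properties as Bool
open import Data.Bool.Properties using (T?; T-irrelevant; T-∨)
import Data.Fin as Fin
open import Data.Fin using (Fin; zero; suc; toℕ; fromℕ<; inject₁; _≟_; _↑ˡ_; _↑ʳ_)
open import Data.Fin.Patterns
open import Data.Fin.Properties
  using (any?; all?; injective⇒≤; toℕ-injective; toℕ-inject₁; toℕ-fromℕ<; toℕ<n; ↑ˡ-injective)
open import Data.Fin.Subset using (Subset; inside; outside; _∈_; _∉_; _⊆_; ∣_∣; _∪_; ⁅_⁆)
open import Data.Fin.Subset.Properties
  using (anySubset?; _∈?_; _⊆?_; nonempty?; x∈⁅x⁆; x∈⁅y⁆⇒x≡y; x∈p∪q⁻; p⊆p∪q; q⊆p∪q)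
open import Data.List using (List; []; _∷_; _++_; length; lookup; map; allFin; cartesianProduct)
import Data.List.Membership.Propositional as List
open import Data.List.Membership.Propositional.Properties
  using (∈-allFin; ∈-lookup; ∈-map⁺; ∈-++⁺ˡ; ∈-++⁺ʳ; ∈-filter⁻)
open import Data.List.Membership.Setoid.Properties using (index-injective)
open import Data.List.Properties using (filter-≐; length-map; length-++; length-tabulate)
import Data.List.Relation.Unary.All as All
import Data.List.Relation.Unary.All.Properties as All
open import Data.List.Relation.Unary.All using (All; []; _∷_)
import Data.List.Relation.Unary.AllPairs as AllPairs
import Data.List.Relation.Unary.AllPairs.Properties as AllPairs
open import Data.List.Relation.Unary.AllPairs using (AllPairs; allPairs?; []; _∷_)
open import Data.List.Relation.Unary.Any using (here; there; index)
import Data.List.Relation.Unary.Linked as Linked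
open import Data.List.Relation.Unary.Linked using (Linked; linked?; []; [-]; _∷_)
open import Data.List.Relation.Unary.Unique.DecPropositional using (unique?)
open import Data.List.Relation.Unary.Unique.Propositional using (Unique)
import Data.List.Relation.Unary.Unique.Propositional.Properties as Unique
open import Data.Nat using (ℕ; zero; suc; _+_; _*_; _∸_; _⊓_; _≡ᵇ_; _≤_; _<_; _≤?_; z≤n; s≤s)
open import Data.Nat.Induction using (<-rec)
import Data.Nat.Properties as ℕ
open import Data.Product using (Σ; ∃; ∃-syntax; _×_; _,_; proj₁; proj₂; map₂; swap)
import Data.Sum as Sum
open import Data.Sum using (_⊎_; inj₁; inj₂; [_,_]′)
open import Data.Vec using ([]; _∷_; here; there)
open import Function using (_∘_; id; Equivalence)
open import Level using (0ℓ)
import Relation.Binary as B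
open import Relation.Binary using (Rel; Reflexive; Symmetric; _Respects_)
import Relation.Binary.Construct.Closure.ReflexiveTransitive as Star
open import Relation.Binary.Construct.Closure.ReflexiveTransitive using (Star; ε; _◅_; _◅◅_)
open import Relation.Binary.PropositionalEquality
  using (_≡_; _≢_; refl; sym; trans; cong; cong₂; subst; setoid; ≢-sym)
open import Relation.Nullary using (¬_; Dec; yes; no; ¬?; contradiction)
open import Relation.Nullary.Decidable
  using (map′; _×-dec_; _⊎-dec_; _→-dec_; decidable-stable; ⌊_⌋; toWitness; fromWitness)
open import Relation.Unary using (Decidable)

-- Least witnesses and counting

private variable
  m n r : ℕ

-- Strong induction: either some smaller number satisfies `P` and the recursion takes over, or `m`
-- itself is least. Keeping `k ≤ m` turns any explicit witness into an upper bound.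
minimum : {P : ℕ → Set} → Decidable P → ∀ m → P m → ∃[ k ] (IsMinimum P k × k ≤ m)
minimum {P} P? = <-rec _ step
  where
  step : ∀ m → (∀ {j} → j < m → P j → ∃[ k ] (IsMinimum P k × k ≤ j)) →
         P m → ∃[ k ] (IsMinimum P k × k ≤ m)
  step m rec pm with ℕ.anyUpTo? P? m
  ... | yes (j , j<m , pj) = let k , min , k≤j = rec j<m pj in k , min , ℕ.≤-trans k≤j (ℕ.<⇒≤ j<m)
  ... | no none = m , (pm , λ j pj → ℕ.≮⇒≥ λ j<m → none (j , j<m , pj)) , ℕ.≤-refl

lookup-injective : {A : Set} {xs : List A} → Unique xs → ∀ i j → lookup xs i ≡ lookup xs j → i ≡ j
lookup-injective (_ ∷ _)  zero    zero    _  = refl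
lookup-injective (x∉ ∷ _) zero    (suc j) eq = contradiction eq (All.lookup x∉ (∈-lookup j))
lookup-injective (x∉ ∷ _) (suc i) zero    eq = contradiction (sym eq) (All.lookup x∉ (∈-lookup i))
lookup-injective (_ ∷ u)  (suc i) (suc j) eq = cong suc (lookup-injective u i j eq)

-- Sending a position in `xs` to the position of the same element in `ys` is injective, so the
-- pigeonhole principle applies.
Unique-⊆⇒length≤ : {A : Set} {xs ys : List A} → Unique xs →
                   (∀ {x} → x List.∈ xs → x List.∈ ys) → length xs ≤ length ys
Unique-⊆⇒length≤ {A} u xs⊆ys =
  injective⇒≤ {f = λ i → index (xs⊆ys (∈-lookup i))} λ {i} {j} eq →
    lookup-injective u i j (index-injective (setoid A) (xs⊆ys (∈-lookup _)) (xs⊆ys (∈-lookup _)) eq)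

-- Exhaustive search

-- Functions out of Fin n can only be enumerated up to pointwise equality, so
-- search is restricted to predicates that respect a given relation.
Searchable : (A : Set) → Rel A 0ℓ → Set₁
Searchable A _≈_ = {P : A → Set} → P Respects _≈_ → Decidable P → Dec (∃ P)

Pointwise : {I : Set} {A : I → Set} → (∀ i → Rel (A i) 0ℓ) → Rel (∀ i → A i) 0ℓ
Pointwise R f g = ∀ i → R i (f i) (g i)

cons : {A : Fin (suc n) → Set} → A zero → (∀ i → A (suc i)) → ∀ i → A i
cons a f zero    = a
cons a f (suc i) = f i

-- Nested search, first for the value at `zero` and then for the remaining function. A given `f` is
-- only pointwise related to its reassembly by `cons`, which is where reflexivity and `resp` enter.
search-Π : {A : Fin n → Set} {R : ∀ i → Rel (A i) 0ℓ} → (∀ i → Reflexive (R i)) →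
           (∀ i → Searchable (A i) (R i)) → Searchable (∀ i → A i) (Pointwise R)
search-Π {zero} rfl search resp P? =
  map′ (_ ,_) (λ (f , pf) → resp (λ ()) pf) (P? λ ())
search-Π {suc n} rfl search {P} resp P? =
  map′ (λ (a , f , p) → cons a f , p)
       (λ (f , p) → f zero , f ∘ suc , resp (λ { zero → rfl _ ; (suc i) → rfl _ }) p)
       (search zero
         (λ a≈b (f , p) → f , resp (λ { zero → a≈b ; (suc i) → rfl _ }) p)
         (λ a → search-Π (rfl ∘ suc) (search ∘ suc)
           (λ f≈g → resp λ { zero → rfl _ ; (suc i) → f≈g i })
           (λ f → P? (cons a f))))

search-Bool : Searchable Bool _≡_
search-Bool resp P? =
  map′ [ true ,_ , false ,_ ]′ (λ { (true , p) → inj₁ p ; (false , p) → inj₂ p })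
       (P? true ⊎-dec P? false)

∀T? : ∀ {b} {P : T b → Set} → Decidable P → Dec (∀ p → P p)
∀T? {true}  P? = map′ (λ p _ → p) (λ f → f _) (P? _)
∀T? {false} P? = yes λ ()

search-T→Fin : ∀ b → Searchable (T b → Fin r) (Pointwise λ _ → _≡_)
search-T→Fin true  resp P? =
  map′ (λ (i , p) → _ , p) (λ (f , p) → f _ , resp (λ _ → refl) p) (any? λ i → P? (λ _ → i))
search-T→Fin false resp P? =
  map′ (_ ,_) (λ (f , p) → resp (λ ()) p) (P? λ ())

-- Here `A` stands for the laws of a structure. By `move`, testing `B` at one proof of them settles
-- it for all.
Σ-dec : {A : Set} {B : A → Set} → Dec A → (∀ {x y} → B x → B y) → Decidable B → Dec (Σ A B)
Σ-dec (no ¬a) move B? = no (¬a ∘ proj₁)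
Σ-dec (yes a) move B? = map′ (a ,_) (move ∘ proj₂) (B? a)

search-list : {P : List (Fin n) → Set} → Decidable P → ∀ k → Dec (∃[ xs ] (length xs ≤ k × P xs))
search-list P? zero =
  map′ (λ p → [] , z≤n , p) (λ { ([] , _ , p) → p }) (P? [])
search-list P? (suc k) =
  map′ [ (λ p → [] , z≤n , p) , (λ (x , xs , l , p) → x ∷ xs , s≤s l , p) ]′
       (λ { ([] , _ , p) → inj₁ p ; (x ∷ xs , s≤s l , p) → inj₂ (x , xs , l , p) })
       (P? [] ⊎-dec any? λ x → search-list (P? ∘ (x ∷_)) k)

-- Warshall's algorithm: Via ws is reachability by walks whose inner vertices lie in ws.
module Reachability {R : Rel (Fin n) 0ℓ} (R? : B.Decidable R) where

  Via : List (Fin n) → Rel (Fin n) 0ℓ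
  Via []       u v = u ≡ v ⊎ R u v
  Via (w ∷ ws) u v = Via ws u v ⊎ (Via ws u w × Via ws w v)

  via? : ∀ ws → B.Decidable (Via ws)
  via? []       u v = (u ≟ v) ⊎-dec R? u v
  via? (w ∷ ws) u v = via? ws u v ⊎-dec (via? ws u w ×-dec via? ws w v)

  via⇒star : ∀ ws {u v} → Via ws u v → Star R u v
  via⇒star []       (inj₁ refl)    = ε
  via⇒star []       (inj₂ e)       = e ◅ ε
  via⇒star (w ∷ ws) (inj₁ p)       = via⇒star ws p
  via⇒star (w ∷ ws) (inj₂ (p , q)) = via⇒star ws p ◅◅ via⇒star ws q

  via-weaken : ∀ ws {u v} → Via [] u v → Via ws u v
  via-weaken []       p = p
  via-weaken (w ∷ ws) p = inj₁ (via-weaken ws p)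

  -- If both walks pass through the head of `ws`, the detour between the two visits is cut out, so
  -- the head is still visited only once.
  via-trans : ∀ {ws u w v} → w List.∈ ws → Via ws u w → Via ws w v → Via ws u v
  via-trans (here refl) (inj₁ p)       (inj₁ q)       = inj₂ (p , q)
  via-trans (here refl) (inj₁ p)       (inj₂ (_ , q)) = inj₂ (p , q)
  via-trans (here refl) (inj₂ (p , _)) (inj₁ q)       = inj₂ (p , q)
  via-trans (here refl) (inj₂ (p , _)) (inj₂ (_ , q)) = inj₂ (p , q)
  via-trans (there m) (inj₁ p)       (inj₁ q)       = inj₁ (via-trans m p q)
  via-trans (there m) (inj₁ p)       (inj₂ (q , s)) = inj₂ (via-trans m p q , s)
  via-trans (there m) (inj₂ (p , s)) (inj₁ q)       = inj₂ (p , via-trans m s q)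
  via-trans (there m) (inj₂ (p , _)) (inj₂ (_ , q)) = inj₂ (p , q)

  star⇒via : ∀ {u v} → Star R u v → Via (allFin n) u v
  star⇒via ε       = via-weaken (allFin n) (inj₁ refl)
  star⇒via (e ◅ p) = via-trans (∈-allFin _) (via-weaken (allFin n) (inj₂ e)) (star⇒via p)

  star? : B.Decidable (Star R)
  star? u v = map′ (via⇒star (allFin n)) star⇒via (via? (allFin n) u v)

-- Decidability of the graph notions

adj? : (G : Graph n) → B.Decidable (Adj G)
adj? G u v = T? _

connected? : Decidable (Connected {n})
connected? G = all? λ u → all? λ v → Reachability.star? (adj? G) u v

-- Distinctness bounds the length of `vs` by `n`, which makes the search finite.
cycle? : Decidable (Cycle {n})
cycle? {n} G = any? λ v →
  map′ (λ (vs , _ , c) → vs , c)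
       (λ { (vs , c@(_ , (_ ∷ u) , _)) → vs , length≤n u , c })
       (search-list (λ vs → (2 ≤? length vs) ×-dec allPairs? (λ x y → ¬? (x ≟ y)) (v ∷ vs)
                             ×-dec linked? (adj? G) (v ∷ vs ++ v ∷ [])) n)
  where
  length≤n : {vs : List (Fin n)} → Unique vs → length vs ≤ n
  length≤n {vs} u = injective⇒≤ (λ {i} {j} → lookup-injective u i j)

-- A record rather than a bare function type, so that both graphs can be inferred from the type of a
-- proof.
record _≐_ (G G′ : Graph n) : Set where
  constructor pointwise
  field adj≡ : ∀ u v → Graph.adj G u v ≡ Graph.adj G′ u v

open _≐_

≐-refl : {G : Graph n} → G ≐ G
≐-refl .adj≡ _ _ = refl

≐-sym : {G G′ : Graph n} → G ≐ G′ → G′ ≐ G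
≐-sym eq .adj≡ u v = sym (adj≡ eq u v)

≐⇒Adj : {G G′ : Graph n} → G ≐ G′ → ∀ {u v} → Adj G u v → Adj G′ u v
≐⇒Adj eq = subst T (adj≡ eq _ _)

search-Graph : Searchable (Graph n) _≐_
search-Graph {n} {P} resp P? =
  map′ (λ (_ , (s , i) , p) → graph _ s i , p)
       (λ (G , p) → Graph.adj G , (Graph.adj-sym G , Graph.adj-irrefl G) , p)
       (search-Π (λ _ _ → refl) (λ _ → search-Π (λ _ → refl) (λ _ → search-Bool))
         (λ eq ((s , i) , p) →
           ( (λ u v → trans (sym (eq u v)) (trans (s u v) (eq v u)))
           , (λ u → trans (sym (eq u u)) (i u)))
           , resp (pointwise eq) p)
         (λ a → Σ-dec ((all? λ u → all? λ v → a u v Bool.≟ a v u) ×-dec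
                       (all? λ u → a u u Bool.≟ false))
                      (resp (pointwise λ _ _ → refl)) (λ (s , i) → P? (graph a s i))))
  where
  graph : (a : Fin n → Fin n → Bool) → (∀ u v → a u v ≡ a v u) → (∀ u → a u u ≡ false) → Graph n
  graph a s i = record { adj = a ; adj-sym = s ; adj-irrefl = i }

_≈ᶜ_ : {G : Graph n} → Rel (EdgeColoring G r) 0ℓ
_≈ᶜ_ {G = G} c c′ = ∀ {u v} (p : Adj G u v) → colour c p ≡ colour c′ p

search-EdgeColoring : (G : Graph n) → Searchable (EdgeColoring G r) _≈ᶜ_
search-EdgeColoring {n} {r} G {P} resp P? =
  map′ (λ (_ , s , p) → coloring _ s , p)
       (λ (c , p) → (λ _ _ → colour c) , (λ _ _ → EdgeColoring.colour-sym c) , p)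
       (search-Π (λ _ _ _ → refl) (λ _ → search-Π (λ _ _ → refl) (λ _ → search-T→Fin _))
         (λ eq (s , p) →
           (λ u v e f → trans (sym (eq u v e)) (trans (s u v e f) (eq v u f)))
           , resp (eq _ _) p)
         (λ f → Σ-dec (all? λ u → all? λ v → ∀T? λ p → ∀T? λ q → f u v p ≟ f v u q)
                      (resp λ _ → refl) (λ s → P? (coloring f s))))
  where
  coloring : (f : ∀ u v → Adj G u v → Fin r) → (∀ u v p q → f u v p ≡ f v u q) → EdgeColoring G r
  coloring f s = record { colour = f _ _ ; colour-sym = s _ _ }

_≈ˢ_ : {G : Graph n} → Rel (Subgraph G) 0ℓ
H ≈ˢ H′ = vertices H ≡ vertices H′ × edgeSet H ≐ edgeSet H′

search-Subgraph : (G : Graph n) → Searchable (Subgraph G) _≈ˢ_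
search-Subgraph {n} G {P} resp P? =
  map′ (λ (V , E , (e , f) , p) → subgraph V E e f , p)
       (λ (H , p) → vertices H , edgeSet H
                  , ((λ _ _ → edge⇒Adj H) , (λ _ _ → Subgraph.edge⇒end H)) , p)
       (anySubset? λ V → search-Graph
         (λ eq ((e , f) , p) →
           ( (λ u v → e u v ∘ ≐⇒Adj (≐-sym eq)) , (λ u v → f u v ∘ ≐⇒Adj (≐-sym eq)))
           , resp (refl , eq) p)
         (λ E → Σ-dec ((all? λ u → all? λ v → adj? E u v →-dec adj? G u v) ×-dec
                       (all? λ u → all? λ v → adj? E u v →-dec ((u ∈? V) ×-dec (v ∈? V))))
                      (resp (refl , ≐-refl)) (λ (e , f) → P? (subgraph V E e f))))
  where
  subgraph : (V : Subset n) (E : Graph n) → (∀ u v → Adj E u v → Adj G u v) →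
             (∀ u v → Adj E u v → u ∈ V × v ∈ V) → Subgraph G
  subgraph V E e f = record { vertices = V ; edgeSet = E ; edge⇒Adj = e _ _ ; edge⇒end = f _ _ }

isTree? : {G : Graph n} → Decidable (IsTree {G = G})
isTree? H =
  map′ (λ (ne , c , a) → record { nonempty = ne ; connected = c _ _ ; acyclic = a })
       (λ t → IsTree.nonempty t , (λ _ _ → IsTree.connected t) , IsTree.acyclic t)
       (nonempty? (vertices H)
         ×-dec (all? λ u → all? λ v → (u ∈? vertices H) →-dec ((v ∈? vertices H) →-dec
                  Reachability.star? (adj? (edgeSet H)) u v))
         ×-dec ¬? (cycle? (edgeSet H)))

rainbow? : {G : Graph n} (c : EdgeColoring G r) → Decidable (Rainbow c)
rainbow? c H =
  map′ (λ f → f _ _ _ _) (λ f _ _ _ _ → f)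
    (all? λ u → all? λ v → all? λ x → all? λ y → ∀T? λ p → ∀T? λ q →
      (colour c (edge⇒Adj H p) ≟ colour c (edge⇒Adj H q)) →-dec
      (((u ≟ x) ×-dec (v ≟ y)) ⊎-dec ((u ≟ y) ×-dec (v ≟ x))))

Cycle-mono : {E E′ : Graph n} → (∀ {u v} → Adj E u v → Adj E′ u v) → Cycle E → Cycle E′
Cycle-mono f (v , vs , l , u , w) = v , vs , l , u , Linked.map f w

-- The ambient graphs may differ, so the same lemmas serve for replacing a subgraph and for
-- replacing the graph around it.
module _ {G G′ : Graph n} {H : Subgraph G} {H′ : Subgraph G′}
         (V≡ : vertices H ≡ vertices H′) (E≐ : edgeSet H ≐ edgeSet H′) where

  IsTree-transfer : IsTree H → IsTree H′
  IsTree-transfer t = record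
    { nonempty  = map₂ (subst (_ ∈_) V≡) nonempty
    ; connected = λ u∈ v∈ → Star.map (≐⇒Adj E≐)
                    (connected (subst (_ ∈_) (sym V≡) u∈) (subst (_ ∈_) (sym V≡) v∈))
    ; acyclic   = acyclic ∘ Cycle-mono {E = edgeSet H′} {edgeSet H} (≐⇒Adj (≐-sym E≐))
    }
    where open IsTree t

  Rainbow-transfer : {c : EdgeColoring G r} {c′ : EdgeColoring G′ r} →
    (∀ {u v} (p : Adj G u v) (p′ : Adj G′ u v) → colour c p ≡ colour c′ p′) →
    Rainbow c H → Rainbow c′ H′
  Rainbow-transfer c≈ rb p q eq =
    rb (≐⇒Adj (≐-sym E≐) p) (≐⇒Adj (≐-sym E≐) q) (trans (c≈ _ _) (trans eq (sym (c≈ _ _))))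

rainbowTree? : {G : Graph n} (c : EdgeColoring G r) → Decidable (RainbowTree c)
rainbowTree? {G = G} c S = search-Subgraph G
  (λ { {H} {H′} (refl , E≐) (t , rb , S⊆) →
       IsTree-transfer {H = H} {H′} refl E≐ t
     , Rainbow-transfer {H = H} {H′} refl E≐ {c = c} {c}
         (λ p p′ → cong (colour c) (T-irrelevant p p′)) rb
     , S⊆ })
  (λ H → isTree? H ×-dec rainbow? c H ×-dec (S ⊆? vertices H))

-- A search for a counterexample; since `P` is decidable, the absence of one yields `P` everywhere.
∀Subset? : {P : Subset n → Set} → Decidable P → Dec (∀ S → P S)
∀Subset? P? =
  map′ (λ none S → decidable-stable (P? S) (none ∘ (S ,_))) (λ f (S , ¬p) → ¬p (f S))
       (¬? (anySubset? (¬? ∘ P?)))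

isRainbowColoring? : {G : Graph n} (k : ℕ) → Decidable (IsRainbowColoring {r = r} {G} k)
isRainbowColoring? k c = ∀Subset? λ S → (∣ S ∣ ℕ.≟ k) →-dec rainbowTree? c S

IsRainbowColoring-transfer : {G G′ : Graph n} (k : ℕ)
  (c : EdgeColoring G r) (c′ : EdgeColoring G′ r) → G ≐ G′ →
  (∀ {u v} (p : Adj G u v) (p′ : Adj G′ u v) → colour c p ≡ colour c′ p′) →
  IsRainbowColoring k c → IsRainbowColoring k c′
IsRainbowColoring-transfer {n} {G = G} {G′} k c c′ G≐ c≈ rc S ∣S∣≡k with rc S ∣S∣≡k
... | H , t , rb , S⊆ =
  H′ , IsTree-transfer {H = H} {H′} refl ≐-refl t
     , Rainbow-transfer {H = H} {H′} refl ≐-refl {c = c} {c′} c≈ rb , S⊆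
  where
  H′ : Subgraph G′
  H′ = record { vertices = vertices H ; edgeSet = edgeSet H
              ; edge⇒Adj = ≐⇒Adj G≐ ∘ edge⇒Adj H ; edge⇒end = Subgraph.edge⇒end H }

Colourable : ℕ → Graph n → ℕ → Set
Colourable k G r = Σ (EdgeColoring G r) (IsRainbowColoring k)

colourable? : ∀ k (G : Graph n) → Decidable (Colourable k G)
colourable? k G r = search-EdgeColoring G
  (λ {c} {c′} c≈ → IsRainbowColoring-transfer k c c′ ≐-refl
     (λ p p′ → trans (c≈ p) (cong (colour c′) (T-irrelevant p p′))))
  (isRainbowColoring? k)

Colourable-transfer : ∀ k {G G′ : Graph n} → G ≐ G′ → Colourable k G r → Colourable k G′ r
Colourable-transfer k {G} {G′} G≐ (c , rc) =
  c′ , IsRainbowColoring-transfer k c c′ G≐ (λ _ _ → cong (colour c) (T-irrelevant _ _)) rc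
  where
  c′ : EdgeColoring G′ _
  c′ = record { colour = colour c ∘ ≐⇒Adj (≐-sym G≐)
              ; colour-sym = λ _ _ → EdgeColoring.colour-sym c _ _ }

rainbowIndex≤ : ∀ k (G : Graph n) {r ℓ} → r ≤ ℓ → Colourable k G r → RainbowIndex≤ k G ℓ
rainbowIndex≤ k G r≤ℓ col =
  let m , min , m≤r = minimum (colourable? k G) _ col in m , min , ℕ.≤-trans m≤r r≤ℓ

-- An exact index at most `ℓ` exists as soon as some palette of at most `ℓ` colours works, so
-- finitely many palettes need to be tried.
rainbowIndex≤? : ∀ k ℓ → Decidable (λ (G : Graph n) → RainbowIndex≤ k G ℓ)
rainbowIndex≤? k ℓ G =
  map′ (λ (r , r<1+ℓ , col) → rainbowIndex≤ k G (ℕ.≤-pred r<1+ℓ) col)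
       (λ (r , (col , _) , r≤ℓ) → r , s≤s r≤ℓ , col)
       (ℕ.anyUpTo? (colourable? k G) (suc ℓ))

-- Searching for the minimum size

Edge : Graph n → Fin n × Fin n → Set
Edge G (u , v) = u Fin.< v × Adj G u v

edge? : (G : Graph n) → Decidable (Edge G)
edge? G (u , v) = (u Fin.<? v) ×-dec adj? G u v

size-cong : {G G′ : Graph n} → G ≐ G′ → size G ≡ size G′
size-cong {n} {G} {G′} eq =
  cong length (filter-≐ (edge? G) (edge? G′)
                ( (λ (l , e) → l , ≐⇒Adj eq e) , (λ (l , e) → l , ≐⇒Adj (≐-sym eq) e))
                (cartesianProduct (allFin n) (allFin n)))

HasSize : ℕ → ℕ → ℕ → ℕ → Set
HasSize n k ℓ m = Σ (Graph n) λ G → Connected G × RainbowIndex≤ k G ℓ × size G ≡ m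

hasSize? : ∀ n k ℓ → Decidable (HasSize n k ℓ)
hasSize? n k ℓ m = search-Graph
  (λ { eq (con , (r , (col , min) , r≤ℓ) , sz) →
       (λ u v → Star.map (≐⇒Adj eq) (con u v))
     , (r , (Colourable-transfer k eq col , λ j → min j ∘ Colourable-transfer k (≐-sym eq)) , r≤ℓ)
     , trans (sym (size-cong eq)) sz })
  (λ G → connected? G ×-dec rainbowIndex≤? k ℓ G ×-dec (size G ℕ.≟ m))

-- Trees grown by pendant edges

Adj-sym : (G : Graph n) → Symmetric (Adj G)
Adj-sym G = subst T (Graph.adj-sym G _ _)

module Leaf (E′ : Graph n) {u w : Fin n} (leaf : ∀ {x} → Adj E′ w x → x ≡ u) where

  into : ∀ {x} → Adj E′ x w → x ≡ u
  into = leaf ∘ Adj-sym E′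

  -- Supplies the second cycle neighbour of the starting vertex, the one on the closing edge.
  last-step : ∀ {v} b l → Linked (Adj E′) (b ∷ l ++ v ∷ []) → ∃[ x ] (x List.∈ b ∷ l × Adj E′ x v)
  last-step b []      (e ∷ _) = b , here refl , e
  last-step b (x ∷ l) (_ ∷ p) = let y , y∈ , e = last-step x l p in y , there y∈ , e

  -- A window `p`, `q` slides along the walk. If `q` is `w`, its predecessor and successor both
  -- equal `u`, against distinctness; the successor of the last vertex is `v`, hence the condition
  -- `_≢ v`.
  no-inner-leaf : ∀ {v} p q l → Linked (Adj E′) (p ∷ q ∷ l ++ v ∷ []) →
                  Unique (p ∷ q ∷ l) → All (_≢ v) (p ∷ q ∷ l) → w List.∉ (q ∷ l)
  no-inner-leaf p q [] (e ∷ f ∷ _) _ (p≢v ∷ _) (here refl) =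
    p≢v (trans (into e) (sym (leaf f)))
  no-inner-leaf p q (x ∷ l) (e ∷ f ∷ _) ((_ ∷ p≢x ∷ _) ∷ _) _ (here refl) =
    p≢x (trans (into e) (sym (leaf f)))
  no-inner-leaf p q (x ∷ l) (_ ∷ wk) (_ ∷ u) (_ ∷ ≢v) (there w∈) =
    no-inner-leaf q x l wk u ≢v w∈

  -- A vertex on a cycle has two distinct neighbours, while `w` has only `u`. The first two
  -- positions are treated separately, the others by the sliding window.
  leaf∉cycle : ∀ v vs → 2 ≤ length vs → Unique (v ∷ vs) →
               Linked (Adj E′) (v ∷ vs ++ v ∷ []) → w List.∉ v ∷ vs
  leaf∉cycle v (a ∷ b ∷ l) _ (_ ∷ a∉ ∷ _) (e ∷ _ ∷ wk) (here refl) =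
    let x , x∈ , f = last-step b l wk
    in All.lookup a∉ x∈ (trans (leaf e) (sym (into f)))
  leaf∉cycle v (a ∷ b ∷ l) _ ((_ ∷ v≢b ∷ _) ∷ _) (e ∷ f ∷ _) (there (here refl)) =
    v≢b (trans (into e) (sym (leaf f)))
  leaf∉cycle v (a ∷ b ∷ l) _ (v∉ ∷ u) (_ ∷ wk) (there (there w∈)) =
    no-inner-leaf a b l wk u (All.map ≢-sym v∉) w∈
  leaf∉cycle v []       ()
  leaf∉cycle v (_ ∷ []) (s≤s ())

  module _ (E : Graph n) (off-leaf : ∀ {x y} → x ≢ w → y ≢ w → Adj E′ x y → Adj E x y) where

    linked-off-leaf : ∀ {l} → All (_≢ w) l → Linked (Adj E′) l → Linked (Adj E) l
    linked-off-leaf _                    []      = []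
    linked-off-leaf _                    [-]     = [-]
    linked-off-leaf (x≢ ∷ y≢s@(y≢ ∷ _)) (e ∷ p) = off-leaf x≢ y≢ e ∷ linked-off-leaf y≢s p

    acyclic-leaf : ¬ Cycle E → ¬ Cycle E′
    acyclic-leaf ¬cyc (v , vs , 2≤ , uniq , wk) =
      ¬cyc (v , vs , 2≤ , uniq ,
            linked-off-leaf (All.head ≢w ∷ All.++⁺ (All.tail ≢w) (All.head ≢w ∷ [])) wk)
      where
      ≢w : All (_≢ w) (v ∷ vs)
      ≢w = All.map ≢-sym (All.¬Any⇒All¬ _ (leaf∉cycle v vs 2≤ uniq wk))

-- The lists are only bounds: the tree contains all of `vs`, perhaps more, and its colours lie in
-- `cs`. The tree may thus stay unchanged when a vertex already in it is attached.
record Partial {G : Graph n} (c : EdgeColoring G r)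
               (vs : List (Fin n)) (cs : List (Fin r)) : Set where
  field
    tree    : Subgraph G
    isTree  : IsTree tree
    rainbow : Rainbow c tree
    covers  : ∀ {v} → v List.∈ vs → v ∈ vertices tree
    palette : ∀ {u v} (p : Adj (edgeSet tree) u v) → colour c (edge⇒Adj tree p) List.∈ cs

module _ {G : Graph n} (c : EdgeColoring G r) where

  single : ∀ v → Partial c (v ∷ []) []
  single v = record
    { tree = record
        { vertices = ⁅ v ⁆
        ; edgeSet  = record
            { adj = λ _ _ → false ; adj-sym = λ _ _ → refl ; adj-irrefl = λ _ → refl }
        ; edge⇒Adj = λ ()
        ; edge⇒end = λ ()
        }
    ; isTree = record
        { nonempty  = v , x∈⁅x⁆ v
        ; connected = λ x∈ y∈ →
            subst (Star _ _) (trans (x∈⁅y⁆⇒x≡y _ x∈) (sym (x∈⁅y⁆⇒x≡y _ y∈))) ε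
        ; acyclic   = λ { (_ , [] , () , _) ; (_ , _ ∷ _ , _ , _ , () ∷ _) }
        }
    ; rainbow = λ ()
    ; covers = λ { (here refl) → x∈⁅x⁆ v }
    ; palette = λ ()
    }

  module Pendant (H : Subgraph G) {u w : Fin n} (u∈H : u ∈ vertices H) (w∉H : w ∉ vertices H)
                 (e : Adj G u w) where

    New : Fin n → Fin n → Set
    New x y = (x ≡ u × y ≡ w) ⊎ (x ≡ w × y ≡ u)

    new? : ∀ x y → Dec (New x y)
    new? x y = ((x ≟ u) ×-dec (y ≟ w)) ⊎-dec ((x ≟ w) ×-dec (y ≟ u))

    new-sym : ∀ x y → New x y → New y x
    new-sym _ _ = Sum.swap ∘ Sum.map swap swap

    u≢w : u ≢ w
    u≢w refl = w∉H u∈H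

    module E = Graph (edgeSet H)

    E′ : Graph n
    E′ = record
      { adj        = λ x y → E.adj x y ∨ ⌊ new? x y ⌋
      ; adj-sym    = λ x y → cong₂ _∨_ (E.adj-sym x y)
                       (isYes-cong (new? x y) (new? y x) (new-sym x y) (new-sym y x))
      ; adj-irrefl = λ x → cong₂ _∨_ (E.adj-irrefl x)
                       (¬⇒isNo (new? x x) λ { (inj₁ (p , q)) → u≢w (trans (sym p) q)
                                            ; (inj₂ (p , q)) → u≢w (trans (sym q) p) })
      }
      where
      isYes-cong : ∀ {A B : Set} (a : Dec A) (b : Dec B) → (A → B) → (B → A) → ⌊ a ⌋ ≡ ⌊ b ⌋
      isYes-cong (yes a) (yes b) _ _ = refl
      isYes-cong (no _)  (no _)  _ _ = refl
      isYes-cong (yes a) (no ¬b) f _ = contradiction (f a) ¬b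
      isYes-cong (no ¬a) (yes b) _ g = contradiction (g b) ¬a
      ¬⇒isNo : ∀ {A : Set} (a : Dec A) → ¬ A → ⌊ a ⌋ ≡ false
      ¬⇒isNo (yes a) ¬a = contradiction a ¬a
      ¬⇒isNo (no _)  _  = refl

    old : ∀ {x y} → E.Adj x y → Adj E′ x y
    old {x} {y} = Equivalence.from (T-∨ {E.adj x y}) ∘ inj₁

    new : ∀ {x y} → New x y → Adj E′ x y
    new {x} {y} = Equivalence.from (T-∨ {E.adj x y}) ∘ inj₂ ∘ fromWitness

    view : ∀ {x y} → Adj E′ x y → E.Adj x y ⊎ New x y
    view {x} {y} = Sum.map₂ toWitness ∘ Equivalence.to (T-∨ {E.adj x y})

    new⇒Adj : ∀ {x y} → New x y → Adj G x y
    new⇒Adj (inj₁ (refl , refl)) = e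
    new⇒Adj (inj₂ (refl , refl)) = Adj-sym G e

    V⊆ : vertices H ⊆ vertices H ∪ ⁅ w ⁆
    V⊆ = p⊆p∪q ⁅ w ⁆

    w∈ : w ∈ vertices H ∪ ⁅ w ⁆
    w∈ = q⊆p∪q (vertices H) ⁅ w ⁆ (x∈⁅x⁆ w)

    H′ : Subgraph G
    H′ = record
      { vertices = vertices H ∪ ⁅ w ⁆
      ; edgeSet  = E′
      ; edge⇒Adj = [ edge⇒Adj H , new⇒Adj ]′ ∘ view
      ; edge⇒end = [ (λ p → let x∈ , y∈ = Subgraph.edge⇒end H p in V⊆ x∈ , V⊆ y∈)
                   , (λ { (inj₁ (refl , refl)) → V⊆ u∈H , w∈
                          ; (inj₂ (refl , refl)) → w∈ , V⊆ u∈H }) ]′ ∘ view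
      }

    -- Every vertex is joined to `u`, the new one by the edge `e`; no cycle arises because `w` is a
    -- leaf.
    isTree′ : IsTree H → IsTree H′
    isTree′ t = record
      { nonempty  = w , w∈
      ; connected = λ x∈ y∈ → to-u x∈ ◅◅ Star.reverse (Adj-sym E′) (to-u y∈)
      ; acyclic   = Leaf.acyclic-leaf E′ leaf (edgeSet H)
                      (λ x≢w y≢w p → [ id , (λ { (inj₁ (_ , q)) → contradiction q y≢w
                                               ; (inj₂ (q , _)) → contradiction q x≢w }) ]′ (view p))
                      (IsTree.acyclic t)
      }
      where
      to-u : ∀ {x} → x ∈ vertices H ∪ ⁅ w ⁆ → Star (Adj E′) x u
      to-u x∈ with x∈p∪q⁻ (vertices H) ⁅ w ⁆ x∈
      ... | inj₁ x∈H = Star.map old (IsTree.connected t x∈H u∈H)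
      ... | inj₂ x∈w = new (inj₂ (x∈⁅y⁆⇒x≡y _ x∈w , refl)) ◅ ε
      leaf : ∀ {x} → Adj E′ w x → x ≡ u
      leaf p with view p
      ... | inj₁ q                = contradiction (proj₁ (Subgraph.edge⇒end H q)) w∉H
      ... | inj₂ (inj₁ (q , _))   = contradiction (sym q) u≢w
      ... | inj₂ (inj₂ (_ , x≡u)) = x≡u

    colour-new : ∀ {x y} (p : New x y) → colour c (new⇒Adj p) ≡ colour c e
    colour-new (inj₁ (refl , refl)) = refl
    colour-new (inj₂ (refl , refl)) = EdgeColoring.colour-sym c _ _

    rainbow′ : Rainbow c H →
               (∀ {x y} (p : E.Adj x y) → colour c (edge⇒Adj H p) ≢ colour c e) →
               Rainbow c H′
    rainbow′ rb fresh p q eq with view p | view q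
    ... | inj₁ p′ | inj₁ q′ = rb p′ q′ eq
    ... | inj₁ p′ | inj₂ q′ = contradiction (trans eq (colour-new q′)) (fresh p′)
    ... | inj₂ p′ | inj₁ q′ = contradiction (trans (sym eq) (colour-new p′)) (fresh q′)
    ... | inj₂ (inj₁ (refl , refl)) | inj₂ (inj₁ (refl , refl)) = inj₁ (refl , refl)
    ... | inj₂ (inj₁ (refl , refl)) | inj₂ (inj₂ (refl , refl)) = inj₂ (refl , refl)
    ... | inj₂ (inj₂ (refl , refl)) | inj₂ (inj₁ (refl , refl)) = inj₂ (refl , refl)
    ... | inj₂ (inj₂ (refl , refl)) | inj₂ (inj₂ (refl , refl)) = inj₁ (refl , refl)

  -- If w is already in the tree nothing is added, so no freshness of w is needed.
  attach : ∀ {vs cs u w} → Partial c vs cs → u List.∈ vs → (e : Adj G u w) →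
           colour c e List.∉ cs → Partial c (w ∷ vs) (colour c e ∷ cs)
  attach {w = w} P u∈ e fresh with w ∈? vertices (Partial.tree P)
  ... | yes w∈H = record
    { tree = tree ; isTree = isTree ; rainbow = rainbow
    ; covers = λ { (here refl) → w∈H ; (there v∈) → covers v∈ }
    ; palette = there ∘ palette }
    where open Partial P
  ... | no w∉H = record
    { tree = H′ ; isTree = isTree′ isTree
    ; rainbow = rainbow′ rainbow λ p eq → fresh (subst (List._∈ _) eq (palette p))
    ; covers = λ { (here refl) → w∈ ; (there v∈) → V⊆ (covers v∈) }
    ; palette = palette′ }
    where
    open Partial P
    open Pendant tree (covers u∈) w∉H e
    palette′ : ∀ {x y} (p : Adj E′ x y) → colour c (edge⇒Adj H′ p) List.∈ _
    palette′ p with view p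
    ... | inj₁ q = there (palette q)
    ... | inj₂ q = here (colour-new q)

  -- A building plan without freshness conditions, so that distinctness is checked once for the
  -- whole colour list. The index `k` lets each colour be recorded in a convenient form.
  data Growth : List (Fin n) → List (Fin r) → Set where
    root   : ∀ v → Growth (v ∷ []) []
    branch : ∀ {vs cs u w k} → Growth vs cs → u List.∈ vs → (e : Adj G u w) → colour c e ≡ k →
             Growth (w ∷ vs) (k ∷ cs)

  grow : ∀ {vs cs} → Growth vs cs → Unique cs → Partial c vs cs
  grow (root v)           _          = single v
  grow (branch g u∈ e refl) (k∉ ∷ uniq) = attach (grow g uniq) u∈ e (All.All¬⇒¬Any k∉)

  Spans : List (Fin n) → Set
  Spans xs = Σ (Subgraph G) λ H → IsTree H × Rainbow c H × All (_∈ vertices H) xs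

  spans : ∀ {vs cs xs} → Growth vs cs → Unique cs → All (List._∈ vs) xs → Spans xs
  spans g uniq xs∈ = let open Partial (grow g uniq) in tree , isTree , rainbow , All.map covers xs∈

-- Subsets as sorted lists

members : Subset n → List (Fin n)
members []            = []
members (outside ∷ S) = map suc (members S)
members (inside ∷ S)  = zero ∷ map suc (members S)

length-members : (S : Subset n) → length (members S) ≡ ∣ S ∣
length-members []            = refl
length-members (outside ∷ S) = trans (length-map suc (members S)) (length-members S)
length-members (inside ∷ S)  = cong suc (trans (length-map suc (members S)) (length-members S))

∈-members : {S : Subset n} {v : Fin n} → v ∈ S → v List.∈ members S
∈-members {S = inside ∷ S}  here       = here refl
∈-members {S = outside ∷ S} (there v∈) = ∈-map⁺ suc (∈-members v∈)
∈-members {S = inside ∷ S}  (there v∈) = there (∈-map⁺ suc (∈-members v∈))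

members-sorted : (S : Subset n) → AllPairs Fin._<_ (members S)
members-sorted []            = []
members-sorted (outside ∷ S) = AllPairs.map⁺ (AllPairs.map s≤s (members-sorted S))
members-sorted (inside ∷ S)  =
  All.map⁺ (All.universal (λ _ → s≤s z≤n) _) ∷ AllPairs.map⁺ (AllPairs.map s≤s (members-sorted S))

-- The fan and its colouring

next prev : Fin 3 → Fin 3
next 0F = 1F
next 1F = 2F
next 2F = 0F
prev 0F = 2F
prev 1F = 0F
prev 2F = 1F

prev-next : ∀ a → prev (next a) ≡ a
prev-next 0F = refl
prev-next 1F = refl
prev-next 2F = refl

cyclic : ∀ a b → b ≡ a ⊎ b ≡ next a ⊎ b ≡ prev a
cyclic 0F 0F = inj₁ refl
cyclic 0F 1F = inj₂ (inj₁ refl)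
cyclic 0F 2F = inj₂ (inj₂ refl)
cyclic 1F 0F = inj₂ (inj₂ refl)
cyclic 1F 1F = inj₁ refl
cyclic 1F 2F = inj₂ (inj₁ refl)
cyclic 2F 0F = inj₂ (inj₁ refl)
cyclic 2F 1F = inj₂ (inj₂ refl)
cyclic 2F 2F = inj₁ refl

-- The residue mod 3, defined through `next` so that the rule for successors holds by computation.
residue : ℕ → Fin 3
residue zero    = 0F
residue (suc i) = next (residue i)

-- Colours 0, 1, 2 belong to the spokes and 3, 4, 5 to the rim, so the two kinds never clash.
spoke rim : Fin 3 → Fin 6
spoke = _↑ˡ 3
rim   = 3 ↑ʳ_

fan : ∀ m → Graph (suc m)
fan m = record { adj = adj ; adj-sym = adj-sym ; adj-irrefl = adj-irrefl }
  where
  adj : Fin (suc m) → Fin (suc m) → Bool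
  adj zero    zero    = false
  adj zero    (suc _) = true
  adj (suc _) zero    = true
  adj (suc i) (suc j) = (toℕ j ≡ᵇ suc (toℕ i)) ∨ (toℕ i ≡ᵇ suc (toℕ j))

  adj-sym : ∀ u v → adj u v ≡ adj v u
  adj-sym zero    zero    = refl
  adj-sym zero    (suc _) = refl
  adj-sym (suc _) zero    = refl
  adj-sym (suc i) (suc j) = Bool.∨-comm (toℕ j ≡ᵇ suc (toℕ i)) _

  n≢ᵇ1+n : ∀ k → (k ≡ᵇ suc k) ≡ false
  n≢ᵇ1+n zero    = refl
  n≢ᵇ1+n (suc k) = n≢ᵇ1+n k

  adj-irrefl : ∀ u → adj u u ≡ false
  adj-irrefl zero    = refl
  adj-irrefl (suc i) = cong₂ _∨_ (n≢ᵇ1+n (toℕ i)) (n≢ᵇ1+n (toℕ i))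

-- Defined on all pairs, so it does not depend on a proof of adjacency; the value at two hubs is a
-- default. Taking `⊓` gives a rim edge the residue of its lower end, symmetrically.
hue : Fin (suc m) → Fin (suc m) → Fin 6
hue zero    zero    = 0F
hue zero    (suc i) = spoke (residue (toℕ i))
hue (suc i) zero    = spoke (residue (toℕ i))
hue (suc i) (suc j) = rim (residue (toℕ i ⊓ toℕ j))

hue-sym : (u v : Fin (suc m)) → hue u v ≡ hue v u
hue-sym zero    zero    = refl
hue-sym zero    (suc _) = refl
hue-sym (suc _) zero    = refl
hue-sym (suc i) (suc j) = cong (rim ∘ residue) (ℕ.⊓-comm (toℕ i) (toℕ j))

fanColoring : ∀ m → EdgeColoring (fan m) 6
fanColoring m = record { colour = λ {u} {v} _ → hue u v ; colour-sym = λ {u} {v} _ _ → hue-sym u v }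

fan-connected : ∀ m → Connected (fan m)
fan-connected m u v = to-hub u ◅◅ from-hub v
  where
  to-hub : ∀ u → Star (Adj (fan m)) u zero
  to-hub zero    = ε
  to-hub (suc _) = _ ◅ ε
  from-hub : ∀ v → Star (Adj (fan m)) zero v
  from-hub zero    = ε
  from-hub (suc _) = _ ◅ ε

-- The duplicate-free edge list is contained in a list of `suc m` spokes and `m` rim edges.
fan-size : ∀ m → size (fan (suc m)) ≤ suc m + m
fan-size m = begin
  size F                        ≤⟨ Unique-⊆⇒length≤ unique edge∈ ⟩
  length (spokes ++ rims)       ≡⟨ length-++ spokes ⟩
  length spokes + length rims   ≡⟨ cong₂ _+_ (length-enum (suc m)) (length-enum m) ⟩
  suc m + m                     ∎
  where
  open ℕ.≤-Reasoning
  F = fan (suc m)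

  pairs spokes rims : List (Fin (2 + m) × Fin (2 + m))
  pairs  = cartesianProduct (allFin _) (allFin _)
  spokes = map (λ i → zero , suc i) (allFin (suc m))
  rims   = map (λ i → suc (inject₁ i) , suc (suc i)) (allFin m)

  unique : Unique (Graph.edges F)
  unique = Unique.filter⁺ (edge? F) (Unique.cartesianProduct⁺ (Unique.allFin⁺ _) (Unique.allFin⁺ _))

  length-enum : ∀ k {A : Set} {f : Fin k → A} → length (map f (allFin k)) ≡ k
  length-enum k {f = f} = trans (length-map f (allFin k)) (length-tabulate id)

  listed : ∀ e → Edge F e → e List.∈ spokes ++ rims
  listed (zero  , suc i) _ = ∈-++⁺ˡ (∈-map⁺ _ (∈-allFin i))
  listed (suc i , suc j) (s≤s i<j , adj) with Equivalence.to (T-∨ {toℕ j ≡ᵇ suc (toℕ i)}) adj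
  -- Edges are listed with the smaller end first, so `i` cannot be the successor of `j`.
  ... | inj₂ q = contradiction (ℕ.<⇒≤ (ℕ.≤-reflexive (sym (ℕ.≡ᵇ⇒≡ (toℕ i) _ q)))) (ℕ.<⇒≱ i<j)
  listed (suc i , suc (suc j)) _ | inj₁ q =
    subst (λ i → (suc i , suc (suc j)) List.∈ spokes ++ rims)
      (toℕ-injective (trans (toℕ-inject₁ j) (ℕ.≡ᵇ⇒≡ (toℕ j) (toℕ i) q)))
      (∈-++⁺ʳ spokes (∈-map⁺ _ (∈-allFin j)))

  edge∈ : ∀ {e} → e List.∈ Graph.edges F → e List.∈ spokes ++ rims
  edge∈ = listed _ ∘ proj₂ ∘ ∈-filter⁻ (edge? F) {xs = pairs}

-- Rainbow trees in the fan

module _ {m : ℕ} where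

  _⋖_ : Fin m → Fin m → Set
  i ⋖ j = toℕ j ≡ suc (toℕ i)

  -- The last path vertex has nothing above it; the presence of `j` excludes that case.
  above : {i j : Fin m} → i Fin.< j → ∃[ i′ ] i ⋖ i′
  above {i} {j} i<j = fromℕ< 1+i<m , toℕ-fromℕ< 1+i<m
    where 1+i<m = ℕ.≤-<-trans i<j (toℕ<n j)

  below : {i j : Fin m} → i Fin.< j → ∃[ j′ ] j′ ⋖ j
  below {j = suc j} _ = inject₁ j , cong suc (sym (toℕ-inject₁ j))

  ρ : Fin m → Fin 3
  ρ = residue ∘ toℕ

  ρ-above : ∀ {i j a} → i ⋖ j → ρ i ≡ a → ρ j ≡ next a
  ρ-above i⋖j refl = cong residue i⋖j

  ρ-below : ∀ {i j a} → i ⋖ j → ρ j ≡ a → ρ i ≡ prev a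
  ρ-below i⋖j refl = trans (sym (prev-next _)) (cong prev (sym (cong residue i⋖j)))

  private
    G = fan m
    c = fanColoring m

  hub : Growth c (zero ∷ []) []
  hub = root zero

  attach-spoke : ∀ {vs cs a} i → ρ i ≡ a → Growth c vs cs → zero List.∈ vs →
                 Growth c (suc i ∷ vs) (spoke a ∷ cs)
  attach-spoke i eq g z∈ = branch g z∈ _ (cong spoke eq)

  rim-adj : ∀ {i j} → i ⋖ j → Adj G (suc i) (suc j)
  rim-adj {i} {j} i⋖j = Equivalence.from T-∨ (inj₁ (ℕ.≡⇒≡ᵇ (toℕ j) _ i⋖j))

  rim-hue : ∀ {i j a} → i ⋖ j → ρ i ≡ a → hue (suc i) (suc j) ≡ rim a
  rim-hue i⋖j refl = cong (rim ∘ residue) (ℕ.m≤n⇒m⊓n≡m (ℕ.<⇒≤ (ℕ.≤-reflexive (sym i⋖j))))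

  attach-above : ∀ {vs cs i j a} → i ⋖ j → ρ i ≡ a → Growth c vs cs → suc i List.∈ vs →
                 Growth c (suc j ∷ vs) (rim a ∷ cs)
  attach-above i⋖j eq g i∈ = branch g i∈ (rim-adj i⋖j) (rim-hue i⋖j eq)

  -- The colour is governed by the lower end, which here is the newly reached vertex.
  attach-below : ∀ {vs cs i j a} → i ⋖ j → ρ i ≡ a → Growth c vs cs → suc j List.∈ vs →
                 Growth c (suc i ∷ vs) (rim a ∷ cs)
  attach-below {i = i} {j} i⋖j eq g j∈ =
    branch g j∈ (Adj-sym G {suc i} {suc j} (rim-adj i⋖j))
      (trans (hue-sym (suc j) (suc i)) (rim-hue i⋖j eq))

  -- Positions in the vertex list of a `Growth`, counted from the most recently attached vertex.
  pattern 0th = here refl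
  pattern 1st = there 0th
  pattern 2nd = there 1st
  pattern 3rd = there 2nd
  pattern 4th = there 3rd

  -- Two spokes suffice unless their colours agree; then `i` is reached through its upper neighbour,
  -- whose spoke has the next colour.
  pair-hub : ∀ {i j} → i Fin.< j → Spans c (zero ∷ suc i ∷ suc j ∷ [])
  pair-hub {i} {j} i<j with ρ i ≟ ρ j
  ... | no ≢ = spans c (attach-spoke i refl (attach-spoke j refl hub 0th) 1st)
                 ((≢ ∘ ↑ˡ-injective 3 _ _ ∷ []) ∷ [] ∷ []) (2nd ∷ 0th ∷ 1st ∷ [])
  ... | yes eq =
    let i′ , i⋖i′ = above i<j in
    spans c
      (attach-below i⋖i′ refl
        (attach-spoke i′ (ρ-above i⋖i′ refl) (attach-spoke j (sym eq) hub 0th) 1st)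
        0th)
      -- Distinctness is checked by evaluation for all three residues and then specialised.
      (toWitness {a? = all? λ a → unique? _≟_ (rim a ∷ spoke (next a) ∷ spoke a ∷ [])} _ (ρ i))
      (3rd ∷ 0th ∷ 2nd ∷ [])

  triple-equal : ∀ {i j k} → i Fin.< j → j Fin.< k → ρ i ≡ ρ j → ρ k ≡ ρ j →
                 Spans c (suc i ∷ suc j ∷ suc k ∷ [])
  triple-equal {i} {j} {k} i<j j<k ρi ρk =
    let i′ , i⋖i′ = above i<j
        k′ , k′⋖k = below j<k
        ρk′ = ρ-below k′⋖k ρk
    in spans c
      (attach-above k′⋖k ρk′
        (attach-below i⋖i′ ρi
          (attach-spoke k′ ρk′
            (attach-spoke i′ (ρ-above i⋖i′ ρi) (attach-spoke j refl hub 0th) 1st)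
            2nd)
          1st)
        1st)
      -- With `a` the common residue, the rim colours come from the lower ends `k′` and `i`, and the
      -- spokes to `k′`, `i′` and `j` take one colour from each class.
      (toWitness {a? = all? λ a → unique? _≟_
         (rim (prev a) ∷ rim a ∷ spoke (prev a) ∷ spoke (next a) ∷ spoke a ∷ [])} _ (ρ j))
      (1st ∷ 4th ∷ 0th ∷ [])

  -- The vertex `r` may lie anywhere relative to `p` and `q`. If it occupies the class after theirs,
  -- `q` is reached from below; if the class before, `p` is reached from above.
  pair-equal : ∀ {p q} r → p Fin.< q → ρ p ≡ ρ q → ρ r ≢ ρ p → Spans c (suc p ∷ suc q ∷ suc r ∷ [])
  pair-equal {p} {q} r p<q eq ≢ with cyclic (ρ p) (ρ r)
  ... | inj₁ ρr = contradiction ρr ≢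
  ... | inj₂ (inj₁ ρr) =
    let q′ , q′⋖q = below p<q
        ρq′ = ρ-below q′⋖q (sym eq)
    in spans c
      (attach-above q′⋖q ρq′
        (attach-spoke q′ ρq′ (attach-spoke r ρr (attach-spoke p refl hub 0th) 1st) 2nd)
        0th)
      (toWitness {a? = all? λ a → unique? _≟_
         (rim (prev a) ∷ spoke (prev a) ∷ spoke (next a) ∷ spoke a ∷ [])} _ (ρ p))
      (3rd ∷ 0th ∷ 2nd ∷ [])
  ... | inj₂ (inj₂ ρr) =
    let p′ , p⋖p′ = above p<q
    in spans c
      (attach-below p⋖p′ refl
        (attach-spoke p′ (ρ-above p⋖p′ refl)
          (attach-spoke r ρr (attach-spoke q (sym eq) hub 0th) 1st)
          2nd)
        0th)
      (toWitness {a? = all? λ a → unique? _≟_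
         (rim a ∷ spoke (next a) ∷ spoke (prev a) ∷ spoke a ∷ [])} _ (ρ p))
      (0th ∷ 3rd ∷ 2nd ∷ [])

  triple : ∀ {i j k} → i Fin.< j → i Fin.< k → j Fin.< k → Spans c (suc i ∷ suc j ∷ suc k ∷ [])
  triple {i} {j} {k} i<j i<k j<k with ρ i ≟ ρ j | ρ i ≟ ρ k | ρ j ≟ ρ k
  ... | yes ij | yes ik | _ = triple-equal i<j j<k ij (trans (sym ik) ij)
  ... | yes ij | no  ik | _ = pair-equal k i<j ij (≢-sym ik)
  ... | no  ij | yes ik | _ with pair-equal j i<k ik (≢-sym ij)
  ...   | H , t , rb , (i∈ ∷ k∈ ∷ j∈ ∷ []) = H , t , rb , (i∈ ∷ j∈ ∷ k∈ ∷ [])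
  triple {i} {j} {k} i<j i<k j<k | no ij | no ik | yes jk with pair-equal i j<k jk ij
  ...   | H , t , rb , (j∈ ∷ k∈ ∷ i∈ ∷ []) = H , t , rb , (i∈ ∷ j∈ ∷ k∈ ∷ [])
  triple {i} {j} {k} i<j i<k j<k | no ij | no ik | no jk =
    spans c (attach-spoke i refl (attach-spoke j refl (attach-spoke k refl hub 0th) 1st) 2nd)
      ((ij ∘ ↑ˡ-injective 3 _ _ ∷ ik ∘ ↑ˡ-injective 3 _ _ ∷ [])
        ∷ (jk ∘ ↑ˡ-injective 3 _ _ ∷ []) ∷ [] ∷ [])
      (0th ∷ 1st ∷ 2nd ∷ [])

  -- The hub is the least vertex, so in a sorted triple it can only come first.
  sorted-triple : ∀ {xs} → AllPairs Fin._<_ xs → length xs ≡ 3 → Spans c xs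
  sorted-triple {zero ∷ zero ∷ _} ((() ∷ _) ∷ _)
  sorted-triple {zero ∷ suc i ∷ suc j ∷ []} (_ ∷ (s≤s i<j ∷ []) ∷ _) refl = pair-hub i<j
  sorted-triple {suc i ∷ suc j ∷ suc k ∷ []} ((s≤s i<j ∷ s≤s i<k ∷ []) ∷ (s≤s j<k ∷ []) ∷ _) refl =
    triple i<j i<k j<k

  fan-rainbow : IsRainbowColoring 3 c
  fan-rainbow S ∣S∣≡3 =
    let H , t , rb , xs∈ = sorted-triple (members-sorted S) (trans (length-members S) ∣S∣≡3)
    in H , t , rb , λ v∈ → All.lookup xs∈ (∈-members v∈)

theorem2p10 : (n : ℕ) → 3 ≤ n → ∃[ t ] (IsMinSize n 3 6 t × t ≤ 2 * n ∸ 3)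
theorem2p10 (suc (suc m)) _ =
  -- For `n = 2 + m`, the hub leaves a path on `suc m` vertices; the size of this fan starts the
  -- search for the minimum.
  let F = fan (suc m)
      t , min , t≤size = minimum (hasSize? (2 + m) 3 6) (size F)
        (F , fan-connected (suc m)
           , rainbowIndex≤ 3 F ℕ.≤-refl (fanColoring (suc m) , fan-rainbow) , refl)
  in t , min , ℕ.≤-trans t≤size (ℕ.≤-trans (fan-size m) (ℕ.≤-reflexive (sym (bound m))))
  where
  -- Truncated subtraction is exact here, since the minuend is at least 4.
  bound : ∀ m → 2 * (2 + m) ∸ 3 ≡ suc m + m
  bound m rewrite ℕ.+-identityʳ m | ℕ.+-suc m (suc m) | ℕ.+-suc m m = refl
theorem2p10 (suc zero) (s≤s ())
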